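{- Let $N=2^e\cdot t+1>5$, where $t$ is odd and $2^e>t>0$, and suppose that $5\nmid t$. Then $N$ is prime if and only if $$a^{(N-1)/2}\equiv -1\pmod{N},$$ where $$a=\begin{cases}5, & \text{if } N\equiv 0,2,3\pmod 5;\\[2pt] \dfrac{ -5\pm\sqrt5}{2} \pmod N, & \text{if } N\equiv 4\pmod 5.\end{cases}$$
   Context: Here $e$ and $t$ are integers; numbers $N=2^e\cdot t+1$ with $t$ odd and $2^e>t>0$ are called Proth numbers. Since $5\nmid t$, the case $N\equiv1\pmod 5$ does not occur. $\sqrt{x}\pmod N$ denotes a fixed square root of $x$ modulo $N$, so in the case $N\equiv4\pmod 5$ the symbol $\sqrt5$ denotes a square root of $5$ modulo $N$, and either choice of sign may be used. Division by $2$ is modulo the odd number $N$. -}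

module Defs where

open import Data.Integer.Base using (ℤ; +_; -_; _+_; _-_; _*_)
open import Data.Integer.Divisibility.Signed using (_∣_)
open import Data.Nat.Base using (ℕ)
open import Data.Nat.DivMod using (_%_)
open import Data.Sum.Base using (_⊎_)
open import Relation.Binary.PropositionalEquality using (_≡_)

infix 4 _≡_[mod_]

_≡_[mod_] : ℤ → ℤ → ℕ → Set
x ≡ y [mod N ] = + N ∣ x - y

IsSqrtMod : ℕ → ℤ → ℤ → Set
IsSqrtMod N x s = s * s ≡ x [mod N ]

-- a is the quotient x / 2 modulo N.  For odd N this determines a modulo N.
IsHalfMod : ℕ → ℤ → ℤ → Set
IsHalfMod N x a = + 2 * a ≡ x [mod N ]

-- The admissible values of a, as integer representatives of residues modulo N.
-- This is a relation because √5 need not exist modulo a composite N, and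
-- because any square root s of 5 and either sign may be chosen.
data IsBase (N : ℕ) : ℤ → Set where
  five    : N % 5 ≡ 0 ⊎ N % 5 ≡ 2 ⊎ N % 5 ≡ 3 →
            IsBase N (+ 5)
  plus-√  : ∀ {s a} → N % 5 ≡ 4 → IsSqrtMod N (+ 5) s →
            IsHalfMod N (- (+ 5) + s) a → IsBase N a
  minus-√ : ∀ {s a} → N % 5 ≡ 4 → IsSqrtMod N (+ 5) s →
            IsHalfMod N (- (+ 5) - s) a → IsBase N a

{-# OPTIONS --safe #-}

-- Sufficiency is Proth's argument: for a prime q dividing N, the element
-- a^t has order exactly 2^e modulo q, so q > 2^e > √N.
--
-- Necessity uses Frobenius on fifth roots of unity ζ modulo a prime N.  The
-- Gauss sum τ = 1 + 2(ζ + ζ⁻¹) satisfies τ² = 5, and comparing τ^N = 5^((N-1)/2) τ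
-- with the image of τ under ζ ↦ ζ^N gives 5^((N-1)/2) = ±1.  When N ≡ 4 (mod 5),
-- the roots a of X² + 5X + 5 are the squares (ζ - ζ⁻¹)², and ζ ↦ ζ^N = ζ⁻¹
-- negates ζ - ζ⁻¹, whence a^((N-1)/2) = -1.
module Submission where

open import Defs
open import Algebra.Bundles using (AbelianGroup; CommutativeRing; CommutativeSemiring)
import Algebra.Construct.DirectProduct as DirectProduct
open import Data.Empty using (⊥)
open import Data.Fin.Base using (zero; suc; toℕ; fromℕ; inject₁)
import Data.Fin.Properties as Fin
open import Data.Integer.Base as ℤ using (ℤ; +_; -[1+_])
open import Data.Integer.Divisibility.Signed as ℤ∣ using (_∣_; divides)
import Data.Integer.Properties as ℤ
open import Data.Integer.Tactic.RingSolver using (solve-∀)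
open import Data.List.Base using ([]; _∷_)
open import Data.List.Relation.Unary.All using (_∷_)
open import Data.Nat.Base as ℕ using (ℕ; zero; suc; z≤n; s≤s; z<s; _!)
open import Data.Nat.Combinatorics using (_C_; nCn≡1; nCk≡nC[n∸k]; nCk≡n!/k![n-k]!; k![n∸k]!∣n!)
import Data.Nat.Divisibility as ℕ∣
open import Data.Nat.DivMod using (_%_; _/_; m≡m%n+[m/n]*n; %-distribˡ-*; m%n<n; m*n/n≡m; m/n*n≡m)
open import Data.Nat.ListAction using (product)
open import Data.Nat.Primality
open import Data.Nat.Primality.Factorisation using (factorise)
import Data.Nat.Properties as ℕ
open import Data.Nat.Properties using (_!≢0)
open import Data.Product.Base using (_×_; _,_; ∃; proj₁; proj₂)
open import Data.Sum.Base as Sum using (_⊎_; inj₁; inj₂; [_,_]′)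
open import Data.Vec.Base using (Vec; []; _∷_)
open import Data.Vec.Functional using (replicate; tail; init; last)
open import Function.Base using (id)
open import Function.Bundles using (_⇔_; mk⇔)
open import Level using (0ℓ)
open import Relation.Binary.PropositionalEquality as ≡ using (_≡_; cong; subst)
open import Relation.Nullary using (¬_; yes; no; contradiction)
open import Relation.Nullary.Decidable using (toWitness)

-- Binomial coefficients modulo a prime and the Frobenius identity.

prime∤! : ∀ {p} → Prime p → ∀ m → m ℕ.< p → p ℕ∣.∤ m !
prime∤! pp zero m<p p∣1 = ¬prime[1] (subst Prime (ℕ∣.∣1⇒≡1 p∣1) pp)
prime∤! pp (suc m) m<p p∣m! with euclidsLemma (suc m) (m !) pp p∣m!
... | inj₁ p∣m = ℕ.<⇒≱ m<p (ℕ∣.∣⇒≤ p∣m)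
... | inj₂ p∣m! = prime∤! pp m (ℕ.<-trans (ℕ.n<1+n m) m<p) p∣m!

-- The prime p divides p! = C(p,k) · k! (p-k)!, but neither factorial on the right, since k and p -
-- k are both below p.
prime∣C : ∀ {p} → Prime p → ∀ k → 0 ℕ.< k → k ℕ.< p → p ℕ∣.∣ p C k
prime∣C {p@(suc p′)} pp k 0<k k<p
  with euclidsLemma (p C k) (k ! ℕ.* (p ℕ.∸ k) !) pp (subst (p ℕ∣.∣_) (≡.sym p!≡) (ℕ∣.m∣m*n (p′ !)))
  where
  instance _ = (k !≢0)
  instance _ = ((p ℕ.∸ k) !≢0)
  instance _ = ℕ.m*n≢0 (k !) ((p ℕ.∸ k) !)
  k≤p = ℕ.<⇒≤ k<p
  p!≡ : (p C k) ℕ.* (k ! ℕ.* (p ℕ.∸ k) !) ≡ p !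
  p!≡ = ≡.trans (cong (ℕ._* (k ! ℕ.* (p ℕ.∸ k) !)) (nCk≡n!/k![n-k]! k≤p))
    (m/n*n≡m (k![n∸k]!∣n! k≤p))
... | inj₁ p∣C = p∣C
... | inj₂ p∣! with euclidsLemma (k !) _ pp p∣!
...   | inj₁ p∣k! = contradiction p∣k! (prime∤! pp k k<p)
...   | inj₂ p∣! = contradiction p∣! (prime∤! pp (p ℕ.∸ k) (ℕ.∸-monoʳ-< 0<k (ℕ.<⇒≤ k<p)))

module Frobenius {c ℓ} (S : CommutativeSemiring c ℓ) where
  open CommutativeSemiring S hiding (zero)
  open import Algebra.Properties.Semiring.Exp semiring
  open import Algebra.Properties.Semiring.Mult semiring renaming (_×_ to _·_)
  open import Algebra.Properties.Semiring.Sum semiring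
  open import Algebra.Properties.CommutativeSemiring.Binomial S
  open import Relation.Binary.Reasoning.Setoid setoid

  ∣⇒·≈0 : ∀ {p n} → p · 1# ≈ 0# → p ℕ∣.∣ n → ∀ x → n · x ≈ 0#
  ∣⇒·≈0 {p} p≈0 (ℕ∣.divides q ≡.refl) x = begin
    (q ℕ.* p) · x        ≈⟨ ×-assocˡ x q p ⟨
    q · (p · x)          ≈⟨ ×-congʳ q (×-congʳ p (*-identityˡ x)) ⟨
    q · (p · (1# * x))   ≈⟨ ×-congʳ q (×-assoc-* p 1# x) ⟨
    q · ((p · 1#) * x)   ≈⟨ ×-congʳ q (trans (*-congʳ p≈0) (zeroˡ x)) ⟩
    q · 0#               ≈⟨ sum-replicate q ⟨
    sum (replicate q 0#) ≈⟨ sum-replicate-zero q ⟩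
    0#                   ∎

  -- By `prime∣C`, every term of the binomial expansion except the two outer ones is a multiple of
  -- p, hence zero.
  freshman : ∀ {p} → Prime p → p · 1# ≈ 0# → ∀ x y → (x + y) ^ p ≈ x ^ p + y ^ p
  freshman {zero} pp = contradiction pp ¬prime[0]
  freshman {suc zero} pp = contradiction pp ¬prime[1]
  freshman {p@(suc (suc n))} pp p≈0 x y = begin
    (x + y) ^ p                                    ≈⟨ theorem p x y ⟩
    f zero + sum (tail f)                          ≈⟨ +-congˡ (sum-init-last (tail f)) ⟩
    f zero + (sum (init (tail f)) + last (tail f)) ≈⟨ +-cong f₀ (+-cong mid fₚ) ⟩
    y ^ p + (0# + x ^ p)                           ≈⟨ +-congˡ (+-identityˡ _) ⟩
    y ^ p + x ^ p                                  ≈⟨ +-comm _ _ ⟩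
    x ^ p + y ^ p                                  ∎
    where
    f = binomialTerm x y p
    f₀ : f zero ≈ y ^ p
    f₀ = trans (×-congˡ {1# * y ^ p} (≡.trans (nCk≡nC[n∸k] {0} {p} z≤n) (nCn≡1 p)))
               (trans (+-identityʳ _) (*-identityˡ _))
    fₚ : last (tail f) ≈ x ^ p
    fₚ = trans (×-cong
                  (≡.trans (cong (λ i → p C suc (suc i)) (Fin.toℕ-fromℕ n)) (nCn≡1 p))
                  (*-cong (^-congʳ x (cong (λ i → suc (suc i)) (Fin.toℕ-fromℕ n)))
                          (^-congʳ y (≡.trans (cong (n ℕ.∸_) (Fin.toℕ-fromℕ n)) (ℕ.n∸n≡0 n)))))
               (trans (+-identityʳ _) (*-identityʳ _))
    mid : sum (init (tail f)) ≈ 0#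
    mid = trans (sum-cong-≋ {suc n} {init (tail f)} {replicate (suc n) 0#} λ i →
      ∣⇒·≈0 p≈0 (prime∣C pp (suc (toℕ (inject₁ i))) (s≤s z≤n)
        (s≤s (subst (ℕ._< suc n) (≡.sym (Fin.toℕ-inject₁ i)) (Fin.toℕ<n i)))) _)
      (sum-replicate-zero (suc n))

-- Quadratic extensions and powers in commutative rings.

-- A[x] / (x² − P x − Q), with (a , b) standing for a + b x.
module Quadratic {c ℓ} (A : CommutativeRing c ℓ) (P Q : CommutativeRing.Carrier A) where
  open CommutativeRing A hiding (zero)
  open import Algebra.Solver.Ring.NaturalCoefficients.Default commutativeSemiring
  module G = AbelianGroup (DirectProduct.abelianGroup +-abelianGroup +-abelianGroup)

  infixl 7 _⊛_
  _⊛_ : Carrier × Carrier → Carrier × Carrier → Carrier × Carrier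
  (a , b) ⊛ (c , d) = a * c + Q * (b * d) , a * d + b * c + P * (b * d)

  ⊛-comm : ∀ x y → x ⊛ y G.≈ y ⊛ x
  ⊛-comm (a , b) (c , d) =
    solve 5 (λ a b c d Q → a :* c :+ Q :* (b :* d) := c :* a :+ Q :* (d :* b)) refl a b c d Q ,
    solve 5 (λ a b c d P → a :* d :+ b :* c :+ P :* (b :* d) := c :* b :+ d :* a :+ P :* (d :* b)) refl a b c d P

  ⊛-cong : ∀ {x y u v} → x G.≈ y → u G.≈ v → x ⊛ u G.≈ y ⊛ v
  ⊛-cong (a , b) (c , d) =
    +-cong (*-cong a c) (*-congˡ (*-cong b d)) ,
    +-cong (+-cong (*-cong a d) (*-cong b c)) (*-congˡ (*-cong b d))

  ⊛-assoc : ∀ x y z → (x ⊛ y) ⊛ z G.≈ x ⊛ (y ⊛ z)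
  ⊛-assoc (a , b) (c , d) (e , f) =
    solve 8 (λ a b c d e f P Q →
      (a :* c :+ Q :* (b :* d)) :* e :+ Q :* ((a :* d :+ b :* c :+ P :* (b :* d)) :* f) :=
      a :* (c :* e :+ Q :* (d :* f)) :+ Q :* (b :* (c :* f :+ d :* e :+ P :* (d :* f)))) refl a b c d e f P Q ,
    solve 8 (λ a b c d e f P Q →
      (a :* c :+ Q :* (b :* d)) :* f :+ (a :* d :+ b :* c :+ P :* (b :* d)) :* e
        :+ P :* ((a :* d :+ b :* c :+ P :* (b :* d)) :* f) :=
      a :* (c :* f :+ d :* e :+ P :* (d :* f)) :+ b :* (c :* e :+ Q :* (d :* f))
        :+ P :* (b :* (c :* f :+ d :* e :+ P :* (d :* f)))) refl a b c d e f P Q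

  ⊛-distribˡ : ∀ x y z → x ⊛ (y G.∙ z) G.≈ (x ⊛ y) G.∙ (x ⊛ z)
  ⊛-distribˡ (a , b) (c , d) (e , f) =
    solve 7 (λ a b c d e f Q → a :* (c :+ e) :+ Q :* (b :* (d :+ f)) :=
      (a :* c :+ Q :* (b :* d)) :+ (a :* e :+ Q :* (b :* f))) refl a b c d e f Q ,
    solve 7 (λ a b c d e f P → a :* (d :+ f) :+ b :* (c :+ e) :+ P :* (b :* (d :+ f)) :=
      (a :* d :+ b :* c :+ P :* (b :* d)) :+ (a :* f :+ b :* e :+ P :* (b :* f))) refl a b c d e f P

  ⊛-identityˡ : ∀ x → (1# , 0#) ⊛ x G.≈ x
  ⊛-identityˡ (c , d) =
    solve 3 (λ c d Q → con 1 :* c :+ Q :* (con 0 :* d) := c) refl c d Q ,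
    solve 3 (λ c d P → con 1 :* d :+ con 0 :* c :+ P :* (con 0 :* d) := d) refl c d P

  extension : CommutativeRing c ℓ
  extension = record
    { Carrier = Carrier × Carrier ; _≈_ = G._≈_ ; _+_ = G._∙_ ; _*_ = _⊛_
    ; -_ = G._⁻¹ ; 0# = 0# , 0# ; 1# = 1# , 0#
    ; isCommutativeRing = record
      { isRing = record
        { +-isAbelianGroup = G.isAbelianGroup
        ; *-cong = ⊛-cong
        ; *-assoc = ⊛-assoc
        ; *-identity = ⊛-identityˡ , λ x → G.trans (⊛-comm x _) (⊛-identityˡ x)
        ; distrib = ⊛-distribˡ , λ x y z → G.trans (⊛-comm (y G.∙ z) x)
            (G.trans (⊛-distribˡ x y z) (G.∙-cong (⊛-comm x y) (⊛-comm x z)))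
        }
      ; *-comm = ⊛-comm
      }
    }

module Powers {c ℓ} (A : CommutativeRing c ℓ) where
  open CommutativeRing A hiding (zero)
  open import Algebra.Properties.Semiring.Exp semiring public
  open import Algebra.Properties.Semiring.Mult semiring public using () renaming (_×_ to _·_)
  open import Algebra.Properties.Ring ring public using (-1*x≈-x; -‿involutive)
  open import Relation.Binary.Reasoning.Setoid setoid

  1^n≈1 : ∀ n → 1# ^ n ≈ 1#
  1^n≈1 zero    = refl
  1^n≈1 (suc n) = trans (*-identityˡ _) (1^n≈1 n)

  x^2≈x*x : ∀ x → x ^ 2 ≈ x * x
  x^2≈x*x x = *-congˡ (*-identityʳ x)

  -- For p = 1 + 2h this turns the p-th power of a square root of `a` into the Euler power a^h,
  -- ready to be compared with Frobenius.
  sqrt-^ : ∀ {x a} → x * x ≈ a → ∀ h → x ^ suc (2 ℕ.* h) ≈ x * a ^ h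
  sqrt-^ {x} {a} xx≈a h = *-congˡ (begin
    x ^ (2 ℕ.* h) ≈⟨ ^-assocʳ x 2 h ⟨
    (x ^ 2) ^ h   ≈⟨ ^-congˡ h (trans (x^2≈x*x x) xx≈a) ⟩
    a ^ h         ∎)

  ^-% : ∀ {x} r .{{_ : ℕ.NonZero r}} → x ^ r ≈ 1# → ∀ n → x ^ n ≈ x ^ (n % r)
  ^-% {x} r x^r≈1 n = begin
    x ^ n                             ≈⟨ ^-congʳ x (m≡m%n+[m/n]*n n r) ⟩
    x ^ (n % r ℕ.+ n / r ℕ.* r)       ≈⟨ ^-homo-* x (n % r) (n / r ℕ.* r) ⟩
    x ^ (n % r) * x ^ (n / r ℕ.* r)   ≈⟨ *-congˡ (^-congʳ x (ℕ.*-comm (n / r) r)) ⟩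
    x ^ (n % r) * x ^ (r ℕ.* (n / r)) ≈⟨ *-congˡ (^-assocʳ x r (n / r)) ⟨
    x ^ (n % r) * (x ^ r) ^ (n / r)   ≈⟨ *-congˡ (trans (^-congˡ (n / r) x^r≈1) (1^n≈1 (n / r))) ⟩
    x ^ (n % r) * 1#                  ≈⟨ *-identityʳ _ ⟩
    x ^ (n % r)                       ∎

module Embedding {c ℓ} (A : CommutativeRing c ℓ) (P Q : CommutativeRing.Carrier A) where
  open CommutativeRing A hiding (zero)
  private
    module E = CommutativeRing (Quadratic.extension A P Q)
    module A^ = Powers A
    module E^ = Powers (Quadratic.extension A P Q)

  open import Algebra.Solver.Ring.NaturalCoefficients.Default commutativeSemiring

  ι : Carrier → E.Carrier
  ι a = a , 0#

  *-ι : ∀ a b c → (a , b) E.* ι c E.≈ (a * c , b * c)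
  *-ι a b c =
    solve 4 (λ a b c Q → a :* c :+ Q :* (b :* con 0) := a :* c) refl a b c Q ,
    solve 4 (λ a b c P → a :* con 0 :+ b :* c :+ P :* (b :* con 0) := b :* c) refl a b c P

  ι-^ : ∀ a n → ι a E^.^ n E.≈ ι (a A^.^ n)
  ι-^ a zero    = E.refl
  ι-^ a (suc n) = E.trans (E.*-congˡ {ι a} (ι-^ a n)) (E.trans (*-ι a 0# (a A^.^ n)) (refl , zeroˡ _))

  ι-· : ∀ n → n E^.· E.1# E.≈ ι (n A^.· 1#)
  ι-· zero    = E.refl
  ι-· (suc n) = E.trans (E.+-congˡ {E.1#} (ι-· n)) (refl , +-identityˡ 0#)

  char : ∀ {p} → p A^.· 1# ≈ 0# → p E^.· E.1# E.≈ E.0#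
  char {p} p≈0 = E.trans (ι-· p) (p≈0 , refl)

-- Fifth roots of unity and the action of Frobenius on them.

-- With u² + u = 1 and ζ² = u ζ − 1, ζ is a primitive fifth root of unity and u = ζ + ζ⁻¹.
module Cyclotomic {c ℓ} (A : CommutativeRing c ℓ) (u : CommutativeRing.Carrier A)
                  (u²+u≈1 : CommutativeRing._≈_ A
                    (CommutativeRing._+_ A (CommutativeRing._*_ A u u) u) (CommutativeRing.1# A)) where
  open CommutativeRing A hiding (zero)
  open Embedding A u (- 1#) public
  open Powers A using (-1*x≈-x; -‿involutive)
  private
    R = Quadratic.extension A u (- 1#)
    module R = CommutativeRing R
    module A^ = Powers A
    module F = Frobenius R.commutativeSemiring
  open Powers R using (_^_; ^-congˡ; ^-congʳ; ^-%; ^-assocʳ)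
  open import Relation.Binary.Reasoning.Setoid setoid

  ζ : R.Carrier
  ζ = 0# , 1#

  ζ*- : ∀ c d → ζ R.* (c , d) R.≈ (- d , c + u * d)
  ζ*- c d =
    trans (+-cong (zeroˡ c) (trans (*-congˡ (*-identityˡ d)) (-1*x≈-x d))) (+-identityˡ _) ,
    +-cong (trans (+-cong (zeroˡ d) (*-identityˡ c)) (+-identityˡ c)) (*-congˡ (*-identityˡ d))

  u*u≈1-u : u * u ≈ 1# + - u
  u*u≈1-u = begin
    u * u ≈⟨ +-identityʳ _ ⟨
    u * u + 0# ≈⟨ +-congˡ (-‿inverseʳ u) ⟨
    u * u + (u + - u) ≈⟨ +-assoc _ _ _ ⟨
    u * u + u + - u ≈⟨ +-congʳ u²+u≈1 ⟩
    1# + - u ∎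

  ζ² : ζ ^ 2 R.≈ (- 1# , u)
  ζ² = R.trans (R.*-congˡ {ζ} (R.*-identityʳ ζ)) (R.trans (ζ*- 0# 1#)
    (refl , trans (+-identityˡ _) (*-identityʳ u)))

  ζ³ : ζ ^ 3 R.≈ (- u , - u)
  ζ³ = R.trans (R.*-congˡ {ζ} ζ²) (R.trans (ζ*- (- 1#) u) (refl , (begin
    - 1# + u * u ≈⟨ +-congˡ u*u≈1-u ⟩
    - 1# + (1# + - u) ≈⟨ +-assoc _ _ _ ⟨
    - 1# + 1# + - u ≈⟨ +-congʳ (-‿inverseˡ 1#) ⟩
    0# + - u ≈⟨ +-identityˡ _ ⟩
    - u ∎)))

  ζ⁴ : ζ ^ 4 R.≈ (u , - 1#)
  ζ⁴ = R.trans (R.*-congˡ {ζ} ζ³) (R.trans (ζ*- (- u) (- u)) (-‿involutive u , (begin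
    - u + u * - u ≈⟨ +-cong (-1*x≈-x u) (*-congˡ (-1*x≈-x u)) ⟨
    - 1# * u + u * (- 1# * u) ≈⟨ solve 2 (λ m u → m :* u :+ u :* (m :* u) := m :* (u :* u :+ u)) refl (- 1#) u ⟩
    - 1# * (u * u + u) ≈⟨ *-congˡ u²+u≈1 ⟩
    - 1# * 1# ≈⟨ *-identityʳ _ ⟩
    - 1# ∎)))
    where open import Algebra.Solver.Ring.NaturalCoefficients.Default commutativeSemiring

  ζ⁵ : ζ ^ 5 R.≈ R.1#
  ζ⁵ = R.trans (R.*-congˡ {ζ} ζ⁴) (R.trans (ζ*- u (- 1#)) (-‿involutive 1# , (begin
    u + u * - 1# ≈⟨ +-congˡ (trans (*-comm u _) (-1*x≈-x u)) ⟩
    u + - u ≈⟨ -‿inverseʳ u ⟩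
    0# ∎)))

  module _ {p} (prime : Prime p) (p≈0 : p A^.· 1# ≈ 0#) where
    freshman : ∀ x y → (x R.+ y) ^ p R.≈ x ^ p R.+ y ^ p
    freshman = F.freshman prime (char {p} p≈0)

    -- Since ζ⁻¹ = ζ⁴, u is ζ + ζ⁴. Frobenius acts on each summand, and ζ⁵ = 1 reduces the exponents
    -- modulo 5.
    u^p≈ζ^r+ζ^4r : ∀ {r} → p % 5 ≡ r → ι (u A^.^ p) R.≈ ζ ^ r R.+ ζ ^ ((4 ℕ.* r) % 5)
    u^p≈ζ^r+ζ^4r ≡.refl = R.trans (R.sym (ι-^ u p)) (R.trans (^-congˡ p ιu≈) (R.trans (freshman ζ (ζ ^ 4))
      (R.+-cong (^-% 5 ζ⁵ p)
        (R.trans (^-assocʳ ζ 4 p) (R.trans (^-% 5 ζ⁵ (4 ℕ.* p)) (^-congʳ ζ (%-distribˡ-* 4 p 5)))))))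
      where
      ιu≈ : ι u R.≈ ζ R.+ ζ ^ 4
      ιu≈ = R.sym (R.trans (R.+-congˡ {ζ} ζ⁴) (+-identityˡ u , -‿inverseʳ 1#))

    -- Frobenius swaps the summands ζ and ζ⁴ of u. Both sides lie in the base ring, so comparing
    -- constant coefficients suffices.
    u^p≈u : p % 5 ≡ 4 → u A^.^ p ≈ u
    u^p≈u r = proj₁ (R.trans (u^p≈ζ^r+ζ^4r r)
      (R.trans (R.+-cong ζ⁴ (R.*-identityʳ ζ)) (+-identityʳ u , -‿inverseˡ 1#)))

    ζ²+ζ³ : ζ ^ 2 R.+ ζ ^ 3 R.≈ (- 1# + - u , u + - u)
    ζ²+ζ³ = R.+-cong ζ² ζ³

    -- Frobenius sends ζ + ζ⁴ to ζ² + ζ³, the other root -1 - u of X² + X - 1.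
    u^p≈-1-u : p % 5 ≡ 2 ⊎ p % 5 ≡ 3 → u A^.^ p ≈ - 1# + - u
    u^p≈-1-u (inj₁ r) = proj₁ (R.trans (u^p≈ζ^r+ζ^4r r) ζ²+ζ³)
    u^p≈-1-u (inj₂ r) = proj₁ (R.trans (u^p≈ζ^r+ζ^4r r) (R.trans (R.+-comm (ζ ^ 3) (ζ ^ 2)) ζ²+ζ³))

    -- (- u , 1# + 1#) is 2ζ − u = ζ − ζ⁻¹; the claim compares the coefficients
    -- of ζ in the two values of its p-th power.
    2a^h≈-2 : ∀ {a h} → p ≡ suc (2 ℕ.* h) → p % 5 ≡ 4 →
              (- u , 1# + 1#) R.* (- u , 1# + 1#) R.≈ ι a → (1# + 1#) * a A^.^ h ≈ - 1# + - 1#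
    2a^h≈-2 {a} {h} p≡ p%5≡4 D²≈a = proj₂ (R.trans (R.sym D*a^h) -D)
      where
      D = - u , 1# + 1#
      D*a^h : D ^ p R.≈ (- u * a A^.^ h , (1# + 1#) * a A^.^ h)
      D*a^h = R.trans (^-congʳ D p≡) (R.trans (Powers.sqrt-^ R {D} {ι a} D²≈a h)
        (R.trans (R.*-congˡ {D} (ι-^ a h)) (*-ι (- u) (1# + 1#) (a A^.^ h))))
      ζ^p : ζ ^ p R.≈ (u , - 1#)
      ζ^p = R.trans (^-% 5 ζ⁵ p) (R.trans (^-congʳ ζ p%5≡4) ζ⁴)
      -- Writing 2ζ as ζ + ζ lets Frobenius act on a sum, so 2^p never has to be evaluated.
      D≈ : D R.≈ ι (- u) R.+ (ζ R.+ ζ)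
      D≈ = sym (trans (+-congˡ (+-identityˡ 0#)) (+-identityʳ _)) , sym (+-identityˡ _)
      -D : D ^ p R.≈ ((- u) A^.^ p + (u + u) , - 1# + - 1#)
      -D = R.trans (^-congˡ p {D} D≈) (R.trans (freshman (ι (- u)) (ζ R.+ ζ))
        (R.trans (R.+-cong (ι-^ (- u) p) (R.trans (freshman ζ ζ) (R.+-cong ζ^p ζ^p)))
          (refl , +-identityˡ _)))

-- The ring of integers modulo N.

module ZMod (N : ℕ) where
  -- A record, so that x and y can be inferred from a proof of x ≈ y.
  record _≈_ (x y : ℤ) : Set where
    constructor mod
    field unmod : x ≡ y [mod N ]
  open _≈_ public
  infix 4 _≈_

  reflexive : ∀ {x y} → x ≡ y → x ≈ y
  reflexive {x} ≡.refl = mod (divides (+ 0) (ℤ.+-inverseʳ x))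

  sym : ∀ {x y} → x ≈ y → y ≈ x
  sym {x} {y} (mod x≈y) = mod (subst (+ N ∣_) (identity x y) (ℤ∣.∣m⇒∣-m x≈y))
    where
    identity : ∀ x y → ℤ.- (x ℤ.- y) ≡ y ℤ.- x
    identity = solve-∀

  trans : ∀ {x y z} → x ≈ y → y ≈ z → x ≈ z
  trans {x} {y} {z} (mod x≈y) (mod y≈z) = mod (subst (+ N ∣_) (identity x y z) (ℤ∣.∣m∣n⇒∣m+n x≈y y≈z))
    where
    identity : ∀ x y z → (x ℤ.- y) ℤ.+ (y ℤ.- z) ≡ x ℤ.- z
    identity = solve-∀

  +-cong : ∀ {x y u v} → x ≈ y → u ≈ v → x ℤ.+ u ≈ y ℤ.+ v
  +-cong {x} {y} {u} {v} (mod x≈y) (mod u≈v) = mod (subst (+ N ∣_) (identity x y u v) (ℤ∣.∣m∣n⇒∣m+n x≈y u≈v))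
    where
    identity : ∀ x y u v → (x ℤ.- y) ℤ.+ (u ℤ.- v) ≡ (x ℤ.+ u) ℤ.- (y ℤ.+ v)
    identity = solve-∀

  *-cong : ∀ {x y u v} → x ≈ y → u ≈ v → x ℤ.* u ≈ y ℤ.* v
  *-cong {x} {y} {u} {v} (mod x≈y) (mod u≈v) = mod (subst (+ N ∣_) (identity x y u v)
    (ℤ∣.∣m∣n⇒∣m+n (ℤ∣.∣m⇒∣m*n u x≈y) (ℤ∣.∣n⇒∣m*n y u≈v)))
    where
    identity : ∀ x y u v → (x ℤ.- y) ℤ.* u ℤ.+ y ℤ.* (u ℤ.- v) ≡ x ℤ.* u ℤ.- y ℤ.* v
    identity = solve-∀

  -‿cong : ∀ {x y} → x ≈ y → ℤ.- x ≈ ℤ.- y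
  -‿cong {x} {y} (mod x≈y) = mod (subst (+ N ∣_) (identity x y) (ℤ∣.∣m⇒∣-m x≈y))
    where
    identity : ∀ x y → ℤ.- (x ℤ.- y) ≡ (ℤ.- x) ℤ.- (ℤ.- y)
    identity = solve-∀

  ring : CommutativeRing 0ℓ 0ℓ
  ring = record
    { Carrier = ℤ ; _≈_ = _≈_ ; _+_ = ℤ._+_ ; _*_ = ℤ._*_ ; -_ = ℤ.-_ ; 0# = + 0 ; 1# = + 1
    ; isCommutativeRing = record
      { isRing = record
        { +-isAbelianGroup = record
          { isGroup = record
            { isMonoid = record
              { isSemigroup = record
                { isMagma = record
                  { isEquivalence = record { refl = reflexive ≡.refl ; sym = sym ; trans = trans }
                  ; ∙-cong = +-cong }
                ; assoc = λ x y z → reflexive (ℤ.+-assoc x y z) }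
              ; identity = (λ x → reflexive (ℤ.+-identityˡ x)) , λ x → reflexive (ℤ.+-identityʳ x) }
            ; inverse = (λ x → reflexive (ℤ.+-inverseˡ x)) , λ x → reflexive (ℤ.+-inverseʳ x)
            ; ⁻¹-cong = -‿cong }
          ; comm = λ x y → reflexive (ℤ.+-comm x y) }
        ; *-cong = *-cong
        ; *-assoc = λ x y z → reflexive (ℤ.*-assoc x y z)
        ; *-identity = (λ x → reflexive (ℤ.*-identityˡ x)) , λ x → reflexive (ℤ.*-identityʳ x)
        ; distrib = (λ x y z → reflexive (ℤ.*-distribˡ-+ x y z)) , λ x y z → reflexive (ℤ.*-distribʳ-+ x y z) }
      ; *-comm = λ x y → reflexive (ℤ.*-comm x y) } }

  open Powers ring public

  ^≡^ℤ : ∀ x n → x ^ n ≡ x ℤ.^ n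
  ^≡^ℤ x zero    = ≡.refl
  ^≡^ℤ x (suc n) = cong (x ℤ.*_) (^≡^ℤ x n)

  n·1≡n : ∀ n → n · (+ 1) ≡ + n
  n·1≡n zero    = ≡.refl
  n·1≡n (suc n) = cong (λ m → + 1 ℤ.+ m) (n·1≡n n)

  char : N · (+ 1) ≈ + 0
  char = trans (reflexive (n·1≡n N)) (mod (divides (+ 1)
    (≡.trans (ℤ.+-identityʳ _) (≡.sym (ℤ.*-identityˡ (+ N))))))

  ∣⇒≈0 : ∀ {x} → + N ∣ x → x ≈ + 0
  ∣⇒≈0 {x} N∣x = mod (subst (+ N ∣_) (≡.sym (ℤ.+-identityʳ x)) N∣x)

  ≈0⇒∣ : ∀ {x} → x ≈ + 0 → + N ∣ x
  ≈0⇒∣ {x} (mod N∣x) = subst (+ N ∣_) (ℤ.+-identityʳ x) N∣x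

-- Fermat's little theorem and Euler powers of 5 and of the roots of X² + 5X + 5.

euclidsLemmaℤ : ∀ {p} → Prime p → ∀ x y → + p ∣ x ℤ.* y → + p ∣ x ⊎ + p ∣ y
euclidsLemmaℤ {p} pp x y p∣xy =
  Sum.map ℤ∣.∣ᵤ⇒∣ ℤ∣.∣ᵤ⇒∣ (euclidsLemma ℤ.∣ x ∣ ℤ.∣ y ∣ pp (subst (p ℕ∣.∣_) (ℤ.abs-* x y) (ℤ∣.∣⇒∣ᵤ p∣xy)))

module _ {p} (pp : Prime p) where
  open ZMod p
  open import Relation.Binary.Reasoning.Setoid (CommutativeRing.setoid ring)
  private module F = Frobenius (CommutativeRing.commutativeSemiring ring)

  -- Induction on n through Frobenius: (1 + n)^p = 1 + n^p.
  fermat-ℕ : ∀ n → (+ n) ^ p ≈ + n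
  fermat-ℕ zero = 0^p p (prime⇒nonZero pp)
    where
    0^p : ∀ n → ℕ.NonZero n → (+ 0) ^ n ≈ + 0
    0^p (suc n) _ = reflexive ≡.refl
  fermat-ℕ (suc n) = trans (F.freshman pp char (+ 1) (+ n)) (+-cong (1^n≈1 p) (fermat-ℕ n))

  fermat : ∀ x → x ^ p ≈ x
  fermat (+ n) = fermat-ℕ n
  -- For y = -x, Frobenius gives x^p + y^p = (x + y)^p = 0, which settles negative x without a case
  -- split on the parity of p.
  fermat -[1+ n ] = begin
    x ^ p                         ≈⟨ reflexive (identity (x ^ p) (y ^ p)) ⟩
    (x ^ p ℤ.+ y ^ p) ℤ.- y ^ p   ≈⟨ +-cong (sym (F.freshman pp char x y)) (-‿cong (fermat-ℕ (suc n))) ⟩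
    (x ℤ.+ y) ^ p ℤ.- y           ≈⟨ +-cong x+y^p≈0 (reflexive ≡.refl) ⟩
    + 0 ℤ.- y                     ≡⟨⟩
    x ∎
    where
    x = -[1+ n ]
    y = + suc n
    x+y^p≈0 : (x ℤ.+ y) ^ p ≈ + 0
    x+y^p≈0 = trans (^-congˡ p (reflexive (ℤ.+-inverseˡ y))) (fermat-ℕ 0)
    identity : ∀ a b → a ≡ (a ℤ.+ b) ℤ.- b
    identity = solve-∀

  fermat-unit : ∀ {n} → p ≡ suc n → ∀ x → ¬ (+ p ∣ x) → x ^ n ≈ + 1
  fermat-unit {n} ≡.refl x p∤x
    with euclidsLemmaℤ pp x (x ^ n ℤ.- + 1) (subst (+ p ∣_) (identity x (x ^ n)) (unmod (fermat x)))
    where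
    identity : ∀ a b → a ℤ.* b ℤ.- a ≡ a ℤ.* (b ℤ.- + 1)
    identity = solve-∀
  ... | inj₁ p∣x = contradiction p∣x p∤x
  ... | inj₂ eq  = mod eq

  private
    -- φ is adjoined formally as a root of X² + X - 1, so no square root of 5 modulo p is
    -- presupposed; ζ is adjoined on top of it.
    module B = CommutativeRing (Quadratic.extension ring ℤ.-1ℤ (+ 1))
    module B^ = Powers (Quadratic.extension ring ℤ.-1ℤ (+ 1))
    module E = Embedding ring ℤ.-1ℤ (+ 1)
    -- φ stands for ζ + ζ⁻¹
    φ : B.Carrier
    φ = + 0 , + 1
    module C = Cyclotomic (Quadratic.extension ring ℤ.-1ℤ (+ 1)) φ (reflexive ≡.refl , reflexive ≡.refl)
    module FB = Frobenius B.commutativeSemiring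

    τ : B.Carrier
    τ = B.1# B.+ (φ B.+ φ)

    char-B : p B^.· B.1# B.≈ B.0#
    char-B = E.char {p} char

    τ^p : τ B^.^ p B.≈ B.1# B.+ (φ B^.^ p B.+ φ B^.^ p)
    τ^p = B.trans (FB.freshman pp char-B B.1# (φ B.+ φ))
      (B.+-cong (B^.1^n≈1 p) (FB.freshman pp char-B φ φ))

    -- The two values τ · 5^h and 1 + 2φ^p of τ^p are compared in their constant coefficients; that
    -- of τ = 1 + 2φ is 1.
    5^h≈1+2φ^p : ∀ h → p ≡ suc (2 ℕ.* h) → (+ 5) ^ h ≈ + 1 ℤ.+ (proj₁ (φ B^.^ p) ℤ.+ proj₁ (φ B^.^ p))
    5^h≈1+2φ^p h p≡ = trans (sym (reflexive (ℤ.*-identityˡ ((+ 5) ^ h))))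
      (trans (sym (proj₁ τ*5^h)) (proj₁ τ^p))
      where
      τ*5^h : τ B^.^ p B.≈ (+ 1 ℤ.* (+ 5) ^ h , + 2 ℤ.* (+ 5) ^ h)
      τ*5^h = B.trans (B^.^-congʳ τ p≡) (B.trans (B^.sqrt-^ {τ} {E.ι (+ 5)} (reflexive ≡.refl , reflexive ≡.refl) h)
        (B.trans (B.*-congˡ {τ} (E.ι-^ (+ 5) h)) (E.*-ι (+ 1) (+ 2) ((+ 5) ^ h))))

  -- Here φ^p = φ has constant coefficient 0. Through Euler's criterion this yields the square root
  -- of 5 when N ≡ 4 (mod 5).
  5^h≈1 : ∀ {h} → p ≡ suc (2 ℕ.* h) → p % 5 ≡ 4 → (+ 5) ^ h ≈ + 1
  5^h≈1 {h} p≡ r = trans (5^h≈1+2φ^p h p≡) (+-cong {+ 1} (reflexive ≡.refl) (+-cong eq eq))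
    where eq = proj₁ (C.u^p≈u pp char-B r)

  -- Here φ^p = -1 - φ has constant coefficient -1, and 1 - 2 = -1.
  5^h≈-1 : ∀ {h} → p ≡ suc (2 ℕ.* h) → p % 5 ≡ 2 ⊎ p % 5 ≡ 3 → (+ 5) ^ h ≈ ℤ.-1ℤ
  5^h≈-1 {h} p≡ r = trans (5^h≈1+2φ^p h p≡) (+-cong {+ 1} (reflexive ≡.refl) (+-cong eq eq))
    where eq = proj₁ (C.u^p≈-1-u pp char-B r)

  -- Given the root `a`, the element ζ + ζ⁻¹ already lies in the integers modulo p, so only ζ is
  -- adjoined. The factor 2 is the coefficient of ζ in ζ - ζ⁻¹ = 2ζ - u.
  2a^h≈-2 : ∀ {h a} → p ≡ suc (2 ℕ.* h) → p % 5 ≡ 4 → a ℤ.* a ℤ.+ + 5 ℤ.* a ℤ.+ + 5 ≈ + 0 →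
           + 2 ℤ.* a ^ h ≈ ℤ.- (+ 2)
  2a^h≈-2 {h} {a} p≡ r a-root = Cyclotomic.2a^h≈-2 ring u
    (trans (reflexive (id₁ a)) (+-cong a-root (reflexive ≡.refl))) pp char {a} {h} p≡ r
    (trans (reflexive (id₂ a)) (trans (+-cong a-root (reflexive ≡.refl)) (reflexive (ℤ.+-identityˡ a))) ,
     reflexive (id₃ u))
    where
    -- from a = (ζ − ζ⁻¹)² = u² − 4 and u² = 1 − u
    u = ℤ.- (+ 3) ℤ.- a
    id₁ : ∀ a → (ℤ.- (+ 3) ℤ.- a) ℤ.* (ℤ.- (+ 3) ℤ.- a) ℤ.+ (ℤ.- (+ 3) ℤ.- a) ≡
      (a ℤ.* a ℤ.+ + 5 ℤ.* a ℤ.+ + 5) ℤ.+ + 1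
    id₁ = solve-∀
    id₂ : ∀ a → (ℤ.- (ℤ.- (+ 3) ℤ.- a)) ℤ.* (ℤ.- (ℤ.- (+ 3) ℤ.- a)) ℤ.+ ℤ.- (+ 1) ℤ.* (+ 2 ℤ.* + 2) ≡
      (a ℤ.* a ℤ.+ + 5 ℤ.* a ℤ.+ + 5) ℤ.+ a
    id₂ = solve-∀
    id₃ : ∀ u → (ℤ.- u) ℤ.* + 2 ℤ.+ + 2 ℤ.* (ℤ.- u) ℤ.+ u ℤ.* (+ 2 ℤ.* + 2) ≡ + 0
    id₃ = solve-∀

-- Roots of polynomials modulo p and Euler's criterion.

-- cs stands for the monic polynomial of degree d whose lower coefficients,
-- constant term first, are cs.
eval : ∀ {d} → Vec ℤ d → ℤ → ℤ
eval []       x = + 1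
eval (c ∷ cs) x = c ℤ.+ x ℤ.* eval cs x

-- Horner's scheme: the coefficients of the quotient by X - r are the values at r of the successive
-- tails, and its leading 1 stays implicit.
syntheticQuotient : ∀ {d} → Vec ℤ (suc d) → ℤ → Vec ℤ d
syntheticQuotient (c ∷ [])         r = []
syntheticQuotient (c ∷ cs@(_ ∷ _)) r = eval cs r ∷ syntheticQuotient cs r

eval-syntheticQuotient : ∀ {d} (cs : Vec ℤ (suc d)) r x →
  eval cs x ℤ.- eval cs r ≡ (x ℤ.- r) ℤ.* eval (syntheticQuotient cs r) x
eval-syntheticQuotient (c ∷ [])         r x = identity c r x
  where
  identity : ∀ c r x → (c ℤ.+ x ℤ.* + 1) ℤ.- (c ℤ.+ r ℤ.* + 1) ≡ (x ℤ.- r) ℤ.* + 1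
  identity = solve-∀
eval-syntheticQuotient (c ∷ cs@(_ ∷ _)) r x = ≡.trans
  (identity₁ c r x (eval cs x) (eval cs r))
  (≡.trans (cong (λ y → (x ℤ.- r) ℤ.* eval cs r ℤ.+ x ℤ.* y) (eval-syntheticQuotient cs r x))
    (identity₂ (eval cs r) r x (eval (syntheticQuotient cs r) x)))
  where
  identity₁ : ∀ c r x fx fr → (c ℤ.+ x ℤ.* fx) ℤ.- (c ℤ.+ r ℤ.* fr) ≡ (x ℤ.- r) ℤ.* fr ℤ.+ x ℤ.* (fx ℤ.- fr)
  identity₁ = solve-∀
  identity₂ : ∀ fr r x q → (x ℤ.- r) ℤ.* fr ℤ.+ x ℤ.* ((x ℤ.- r) ℤ.* q) ≡ (x ℤ.- r) ℤ.* (fr ℤ.+ x ℤ.* q)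
  identity₂ = solve-∀

∤1 : ∀ {p} → Prime p → ¬ (+ p ∣ + 1)
∤1 pp p∣1 = ¬prime[1] (subst Prime (ℕ∣.∣1⇒≡1 (ℤ∣.∣⇒∣ᵤ p∣1)) pp)

small∤ : ∀ {p m} → 0 ℕ.< m → m ℕ.< p → ¬ (+ p ∣ + m)
small∤ 0<m m<p p∣m = ℕ.<⇒≱ m<p (ℕ∣.∣⇒≤ {{ℕ.>-nonZero 0<m}} (ℤ∣.∣⇒∣ᵤ p∣m))

-- (X^(2(k+1)) − b^(k+1)) / (X² − b)
cofactor : ℤ → ∀ k → Vec ℤ (k ℕ.* 2)
cofactor b zero    = []
cofactor b (suc k) = b ℤ.^ suc k ∷ + 0 ∷ cofactor b k

-- With y = x², the induction rests on y^(k+2) - b^(k+2) = (y - b) b^(k+1) + y (y^(k+1) - b^(k+1)).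
eval-cofactor : ∀ b k x → (x ℤ.* x ℤ.- b) ℤ.* eval (cofactor b k) x ≡ (x ℤ.* x) ℤ.^ suc k ℤ.- b ℤ.^ suc k
eval-cofactor b zero    x = identity (x ℤ.* x) b
  where
  identity : ∀ y b → (y ℤ.- b) ℤ.* + 1 ≡ y ℤ.* + 1 ℤ.- b ℤ.* + 1
  identity = solve-∀
eval-cofactor b (suc k) x = ≡.trans (identity₁ b x (b ℤ.^ suc k) (eval (cofactor b k) x))
  (≡.trans (cong (λ y → (x ℤ.* x ℤ.- b) ℤ.* b ℤ.^ suc k ℤ.+ x ℤ.* x ℤ.* y) (eval-cofactor b k x))
    (identity₂ (x ℤ.* x) b (b ℤ.^ suc k) ((x ℤ.* x) ℤ.^ suc k)))
  where
  identity₁ : ∀ b x B e → (x ℤ.* x ℤ.- b) ℤ.* (B ℤ.+ x ℤ.* (+ 0 ℤ.+ x ℤ.* e)) ≡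
    (x ℤ.* x ℤ.- b) ℤ.* B ℤ.+ x ℤ.* x ℤ.* ((x ℤ.* x ℤ.- b) ℤ.* e)
  identity₁ = solve-∀
  identity₂ : ∀ y b B Y → (y ℤ.- b) ℤ.* B ℤ.+ y ℤ.* (Y ℤ.- B) ≡ y ℤ.* Y ℤ.- b ℤ.* B
  identity₂ = solve-∀

module _ {p} (pp : Prime p) where
  open ZMod p

  -- Lagrange's bound for the points 1, ..., d + 1. Dividing by X - (d + 1) leaves a quotient that
  -- vanishes at the other points, because their distances to d + 1 are positive and below p.
  ¬vanishes : ∀ {d} → d ℕ.< p → (cs : Vec ℤ d) → ¬ (∀ i → i ℕ.≤ d → + p ∣ eval cs (+ suc i))
  ¬vanishes {zero}  d<p []  roots = ∤1 pp (roots 0 z≤n)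
  ¬vanishes {suc d} d<p cs  roots = ¬vanishes (ℕ.<-trans (ℕ.n<1+n d) d<p) (syntheticQuotient cs r) roots′
    where
    r = + suc (suc d)
    roots′ : ∀ i → i ℕ.≤ d → + p ∣ eval (syntheticQuotient cs r) (+ suc i)
    roots′ i i≤d with euclidsLemmaℤ pp (+ suc i ℤ.- r) _ (subst (+ p ∣_) (eval-syntheticQuotient cs r (+ suc i))
                    (ℤ∣.∣m∣n⇒∣m-n (roots i (ℕ.m≤n⇒m≤1+n i≤d)) (roots (suc d) ℕ.≤-refl)))
    ... | inj₂ p∣q = p∣q
    ... | inj₁ p∣i-r = contradiction (subst (+ p ∣_) r-i≡ (ℤ∣.∣m⇒∣-m p∣i-r))
            (small∤ (ℕ.m<n⇒0<n∸m (s≤s (s≤s i≤d))) (ℕ.≤-<-trans (ℕ.m∸n≤m (suc d) i) d<p))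
      where
      neg-minus : ∀ x y → ℤ.- (x ℤ.- y) ≡ y ℤ.- x
      neg-minus = solve-∀
      r-i≡ : ℤ.- (+ suc i ℤ.- r) ≡ + (suc d ℕ.∸ i)
      r-i≡ = ≡.trans (neg-minus (+ suc i) r)
        (≡.trans (ℤ.m-n≡m⊖n (suc (suc d)) (suc i)) (ℤ.⊖-≥ (s≤s (ℕ.m≤n⇒m≤1+n i≤d))))

  -- Without a square root of b, the cofactor of X² - b in X^(p-1) - 1 would
  -- vanish at all p - 1 nonzero residues, more points than its degree p - 3.
  euler⇒sqrt : ∀ {h b} → p ≡ suc (2 ℕ.* suc h) → b ^ suc h ≈ + 1 → ∃ λ s → s ℤ.* s ≡ b [mod p ]
  -- A search through 0, ..., p - 1 decides whether a square root exists, so the argument by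
  -- contradiction is constructive.
  euler⇒sqrt {h} {b} p≡ b^h≈1 with ℕ.anyUpTo? (λ n → + p ℤ∣.∣? (+ n ℤ.* + n ℤ.- b)) p
  ... | yes (n , _ , eq) = + n , eq
  ... | no  none = contradiction roots (¬vanishes (ℕ.≤-<-trans (ℕ.n≤1+n _) d+1<p) (cofactor b h))
    where
    p≡′ : p ≡ suc (suc (suc (h ℕ.* 2)))
    p≡′ = ≡.trans p≡ (cong suc (ℕ.*-comm 2 (suc h)))
    d+1<p : suc (h ℕ.* 2) ℕ.< p
    d+1<p = subst (suc (h ℕ.* 2) ℕ.<_) (≡.sym p≡′) (s≤s (ℕ.n≤1+n _))
    root : ∀ x → ¬ (+ p ∣ x) → ¬ (+ p ∣ x ℤ.* x ℤ.- b) → + p ∣ eval (cofactor b h) x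
    root x p∤x p∤x²-b = [ (λ p∣x²-b → contradiction p∣x²-b p∤x²-b) , id ]′
      (euclidsLemmaℤ pp (x ℤ.* x ℤ.- b) (eval (cofactor b h) x)
        (subst (+ p ∣_) (≡.sym (eval-cofactor b h x)) (unmod x²^h≈b^h)))
      where
      x²^h≈b^h : (x ℤ.* x) ℤ.^ suc h ≈ b ℤ.^ suc h
      x²^h≈b^h = trans (reflexive (≡.sym (^≡^ℤ (x ℤ.* x) (suc h))))
        (trans (^-congˡ (suc h) (sym (x^2≈x*x x)))
          (trans (^-assocʳ x 2 (suc h))
            (trans (fermat-unit pp p≡ x p∤x)
              (trans (sym b^h≈1) (reflexive (^≡^ℤ b (suc h)))))))
    -- The degree is 2h = p - 3, so `¬vanishes` asks only for the points 1, ..., p - 2.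
    roots : ∀ i → i ℕ.≤ h ℕ.* 2 → + p ∣ eval (cofactor b h) (+ suc i)
    roots i i≤ = root (+ suc i) (small∤ z<s i<p) (λ p∣i²-b → none (suc i , i<p , p∣i²-b))
      where
      i<p : suc i ℕ.< p
      i<p = ℕ.≤-<-trans (s≤s i≤) d+1<p

-- Powers of two dividing orders, and Proth's criterion.

module Order {c ℓ} (A : CommutativeRing c ℓ)
             (-1≉1 : ¬ CommutativeRing._≈_ A (CommutativeRing.-_ A (CommutativeRing.1# A)) (CommutativeRing.1# A)) where
  open CommutativeRing A hiding (zero)
  open Powers A
  open import Relation.Binary.Reasoning.Setoid setoid

  -- (-1)^n = (b^k)^n = (b^n)^k = 1, and -1 differs from 1.
  order-even : ∀ {b} k n → b ^ k ≈ - 1# → b ^ n ≈ 1# → 2 ℕ∣.∣ n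
  order-even {b} k n b^k≈-1 b^n≈1 = ℕ∣.m%n≡0⇒n∣m n 2 (n%2≡0 (n % 2) (m%n<n n 2)
    (trans (sym (^-% 2 -1²≈1 n)) (begin
    (- 1#) ^ n    ≈⟨ ^-congˡ n b^k≈-1 ⟨
    (b ^ k) ^ n   ≈⟨ ^-assocʳ b k n ⟩
    b ^ (k ℕ.* n) ≈⟨ ^-congʳ b (ℕ.*-comm k n) ⟩
    b ^ (n ℕ.* k) ≈⟨ ^-assocʳ b n k ⟨
    (b ^ n) ^ k   ≈⟨ ^-congˡ k b^n≈1 ⟩
    1# ^ k        ≈⟨ 1^n≈1 k ⟩
    1#            ∎)))
    where
    -1²≈1 : (- 1#) ^ 2 ≈ 1#
    -1²≈1 = trans (x^2≈x*x (- 1#)) (trans (-1*x≈-x (- 1#)) (-‿involutive 1#))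
    n%2≡0 : ∀ r → r ℕ.< 2 → (- 1#) ^ r ≈ 1# → r ≡ 0
    n%2≡0 zero          _ _ = ≡.refl
    n%2≡0 (suc zero)    _ eq = contradiction (trans (sym (*-identityʳ (- 1#))) eq) -1≉1
    n%2≡0 (suc (suc _)) (s≤s (s≤s ())) _

  -- Speaking of every exponent n with b^n = 1 avoids defining the order. As n is even, the
  -- induction passes from b and n to b² and n/2.
  2^∣order : ∀ {b} k n → b ^ (2 ℕ.^ k) ≈ - 1# → b ^ n ≈ 1# → 2 ℕ.^ suc k ℕ∣.∣ n
  2^∣order zero    n b^1≈-1 b^n≈1 = order-even 1 n b^1≈-1 b^n≈1
  2^∣order {b} (suc k) n b^≈-1 b^n≈1 with order-even (2 ℕ.^ suc k) n b^≈-1 b^n≈1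
  ... | ℕ∣.divides m ≡.refl = subst (2 ℕ.^ suc (suc k) ℕ∣.∣_) (ℕ.*-comm 2 m)
    (ℕ∣.*-monoʳ-∣ 2 (2^∣order {b ^ 2} k m (trans (^-assocʳ b 2 (2 ℕ.^ k)) b^≈-1)
      (trans (^-assocʳ b 2 m) (trans (^-congʳ b (ℕ.*-comm 2 m)) b^n≈1))))

primeFactor : ∀ n .{{_ : ℕ.NonTrivial n}} → ∃ λ q → Prime q × q ℕ∣.∣ n
primeFactor n@(suc (suc _)) with factorise n
... | record { factors = [] ; isFactorisation = () }
... | record { factors = q ∷ qs ; isFactorisation = n≡ ; factorsPrime = pq ∷ _ } =
      q , pq , subst (q ℕ∣.∣_) (≡.sym n≡) (ℕ∣.m∣m*n (product qs))

-- For b = a^t, Fermat's exponent q - 1 must be a multiple of 2^(k+1), which is therefore less than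
-- q.
2^e<primeFactor : ∀ {q} → Prime q → ∀ {a} k t → ¬ (+ q ∣ + 2) →
                  a ℤ.^ (2 ℕ.^ k ℕ.* t) ≡ ℤ.-1ℤ [mod q ] → 2 ℕ.^ suc k ℕ.< q
2^e<primeFactor {zero} pq = contradiction pq ¬prime[0]
2^e<primeFactor {suc zero} pq = contradiction pq ¬prime[1]
2^e<primeFactor {q@(suc (suc q′))} pq {a} k t q∤2 a^≡-1 =
  s≤s (ℕ∣.∣⇒≤ (2^∣order {b} k (suc q′) b^≈-1 (fermat-unit pq ≡.refl b q∤b)))
  where
  open ZMod q
  b = a ^ t
  -1≉1 : ¬ (ℤ.-1ℤ ≈ + 1)
  -1≉1 (mod q∣-2) = q∤2 (ℤ∣.∣m⇒∣-m q∣-2)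
  open Order ring -1≉1
  b^≈-1 : b ^ (2 ℕ.^ k) ≈ ℤ.-1ℤ
  b^≈-1 = trans (^-assocʳ a t (2 ℕ.^ k)) (trans (^-congʳ a (ℕ.*-comm t (2 ℕ.^ k)))
    (trans (reflexive (^≡^ℤ a (2 ℕ.^ k ℕ.* t))) (mod a^≡-1)))
  ∣b^ : ∀ n → .{{ℕ.NonZero n}} → + q ∣ b → + q ∣ b ^ n
  ∣b^ (suc n) q∣b = ℤ∣.∣m⇒∣m*n (b ^ n) q∣b
  -- If q divided b, then -1 = b^(2^k) would be 0 modulo q.
  q∤b : ¬ (+ q ∣ b)
  q∤b q∣b = ∤1 pq (ℤ∣.∣m⇒∣-m (≈0⇒∣ (trans (sym b^≈-1) (∣⇒≈0 (∣b^ (2 ℕ.^ k) {{ℕ.m^n≢0 2 k}} q∣b)))))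

-- A nontrivial divisor of N up to M = 2^(k+1) would have a prime factor q ≤ M, against
-- `2^e<primeFactor`. Since t < M, also N < (M + 1)², so N is prime.
proth : ∀ {N a} k t → N ≡ 2 ℕ.^ suc k ℕ.* t ℕ.+ 1 → t ℕ.< 2 ℕ.^ suc k → t ℕ.> 0 →
        a ℤ.^ (2 ℕ.^ k ℕ.* t) ≡ ℤ.-1ℤ [mod N ] → Prime N
proth {N} {a} k t N≡ t<M t>0 a^≡-1 = rough∧square>⇒prime {m = suc M}
  {{ℕ.n>1⇒nonTrivial N>1}} rough N<
  where
  M = 2 ℕ.^ suc k
  instance
    _ = ℕ.m^n≢0 2 (suc k)
    _ = ℕ.>-nonZero t>0
  N≡1+ : N ≡ suc (M ℕ.* t)
  N≡1+ = ≡.trans N≡ (ℕ.+-comm _ 1)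
  N>1 : N ℕ.> 1
  N>1 = subst (1 ℕ.<_) (≡.sym N≡1+) (s≤s (ℕ.>-nonZero⁻¹ (M ℕ.* t) {{ℕ.m*n≢0 M t}}))
  N< : suc M ℕ.* suc M ℕ.> N
  N< = subst (ℕ._< suc M ℕ.* suc M) (≡.sym N≡1+)
    (s≤s (ℕ.≤-trans (s≤s (ℕ.*-monoʳ-≤ M (ℕ.≤-trans (ℕ.<⇒≤ t<M) (ℕ.n≤1+n M))))
      (ℕ.+-monoˡ-≤ (M ℕ.* suc M) (ℕ.>-nonZero⁻¹ M))))
  rough : suc M Rough N
  rough (ℕ∣.hasNonTrivialDivisor {d} d<1+M d∣N) with primeFactor d
  ... | q , pq , q∣d = ℕ.<⇒≱ (2^e<primeFactor pq {a} k t q∤2 (ℤ∣.∣-trans (ℤ∣.∣ᵤ⇒∣ q∣N) a^≡-1))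
          (ℕ.≤-trans (ℕ∣.∣⇒≤ {{ℕ.nonTrivial⇒nonZero d}} q∣d) (ℕ.s≤s⁻¹ d<1+M))
    where
    q∣N = ℕ∣.∣-trans q∣d d∣N
    -- Otherwise q would divide both N and N - 1.
    q∤2 : ¬ (+ q ∣ + 2)
    q∤2 q∣2 = ¬prime[1] (subst Prime (ℕ∣.∣1⇒≡1 (ℕ∣.∣m+n∣m⇒∣n (subst (q ℕ∣.∣_) N≡ q∣N)
      (ℕ∣.∣m⇒∣m*n t (ℕ∣.∣m⇒∣m*n (2 ℕ.^ k) (ℤ∣.∣⇒∣ᵤ q∣2))))) pq)

-- Admissible bases modulo a prime N.

cancel-2 : ∀ {p} → Prime p → p ℕ.> 5 → ∀ {x} → + p ∣ + 2 ℤ.* x → + p ∣ x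
cancel-2 pp p>5 {x} p∣2x with euclidsLemmaℤ pp (+ 2) x p∣2x
... | inj₁ p∣2 = contradiction p∣2 (small∤ z<s (ℕ.<-trans (s≤s (s≤s (s≤s z≤n))) p>5))
... | inj₂ p∣x = p∣x

base-^ : ∀ {N h a} → Prime N → N ℕ.> 5 → N ≡ suc (2 ℕ.* h) → IsBase N a → a ℤ.^ h ≡ ℤ.-1ℤ [mod N ]
base-^ {N} {h} {a} pN N>5 N≡ = go
  where
  open ZMod N
  from-root : + N ∣ a ℤ.* a ℤ.+ + 5 ℤ.* a ℤ.+ + 5 → N % 5 ≡ 4 → a ℤ.^ h ≡ ℤ.-1ℤ [mod N ]
  from-root root N%5≡4 = cancel-2 pN N>5 (subst (+ N ∣_)
    (≡.trans (cong (λ y → + 2 ℤ.* y ℤ.- ℤ.- (+ 2)) (^≡^ℤ a h)) (identity (a ℤ.^ h)))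
    (unmod (2a^h≈-2 pN {h} {a} N≡ N%5≡4 (∣⇒≈0 root))))
    where
    identity : ∀ y → + 2 ℤ.* y ℤ.- ℤ.- (+ 2) ≡ + 2 ℤ.* (y ℤ.- ℤ.-1ℤ)
    identity = solve-∀
  -- Completing the square: 4(a² + 5a + 5) = (2a + 5 - s)(2a + 5 + s) + (s² - 5), and the factor 4
  -- is cancelled as 2 twice.
  root : ∀ {s} → IsSqrtMod N (+ 5) s → IsHalfMod N (ℤ.- (+ 5) ℤ.+ s) a → + N ∣ a ℤ.* a ℤ.+ + 5 ℤ.* a ℤ.+ + 5
  root {s} s²≡5 2a≡ = cancel-2 pN N>5 (cancel-2 pN N>5 (subst (+ N ∣_) (identity a s)
    (ℤ∣.∣m∣n⇒∣m+n (ℤ∣.∣m⇒∣m*n (+ 2 ℤ.* a ℤ.+ + 5 ℤ.+ s) 2a≡) s²≡5)))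
    where
    identity : ∀ a s → (+ 2 ℤ.* a ℤ.- (ℤ.- (+ 5) ℤ.+ s)) ℤ.* (+ 2 ℤ.* a ℤ.+ + 5 ℤ.+ s) ℤ.+ (s ℤ.* s ℤ.- + 5) ≡
      + 2 ℤ.* (+ 2 ℤ.* (a ℤ.* a ℤ.+ + 5 ℤ.* a ℤ.+ + 5))
    identity = solve-∀
  neg-sqrt : ∀ {s} → IsSqrtMod N (+ 5) s → IsSqrtMod N (+ 5) (ℤ.- s)
  neg-sqrt {s} = subst (λ y → + N ∣ y ℤ.- + 5) (identity s)
    where
    identity : ∀ s → s ℤ.* s ≡ ℤ.- s ℤ.* ℤ.- s
    identity = solve-∀
  5∤N : N % 5 ≡ 0 → ⊥
  5∤N N%5≡0 with prime⇒irreducible pN (ℕ∣.m%n≡0⇒n∣m N 5 N%5≡0)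
  ... | inj₂ ≡.refl = ℕ.<-irrefl ≡.refl N>5
  go : IsBase N a → a ℤ.^ h ≡ ℤ.-1ℤ [mod N ]
  go (five (inj₁ N%5≡0)) = contradiction N%5≡0 5∤N
  go (five (inj₂ N%5≡23)) = unmod (trans (reflexive (≡.sym (^≡^ℤ (+ 5) h))) (5^h≈-1 pN {h} N≡ N%5≡23))
  go (plus-√ {s} N%5≡4 s²≡5 2a≡) = from-root (root {s} s²≡5 2a≡) N%5≡4
  -- The minus sign is the plus case for the square root -s.
  go (minus-√ {s} N%5≡4 s²≡5 2a≡) = from-root (root { ℤ.- s} (neg-sqrt {s} s²≡5) 2a≡) N%5≡4

-- Modulo N = 2h + 1 the inverse of 2 is h + 1, which gives the witness.
half-base : ∀ {N h} → N ≡ suc (2 ℕ.* h) → N % 5 ≡ 4 → ∀ s → IsSqrtMod N (+ 5) s → ∃ (IsBase N)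
half-base {N} {h} N≡ N%5≡4 s s²≡5 = c ℤ.* (+ h ℤ.+ + 1) , plus-√ {s = s} N%5≡4 s²≡5 (divides c
  (≡.trans (identity c (+ h)) (cong (c ℤ.*_) (≡.sym N≡ℤ))))
  where
  c = ℤ.- (+ 5) ℤ.+ s
  N≡ℤ : + N ≡ + 1 ℤ.+ + 2 ℤ.* + h
  N≡ℤ = ≡.trans (cong +_ N≡) (cong (λ y → + 1 ℤ.+ y) (ℤ.pos-* 2 h))
  identity : ∀ c k → + 2 ℤ.* (c ℤ.* (k ℤ.+ + 1)) ℤ.- c ≡ c ℤ.* (+ 1 ℤ.+ + 2 ℤ.* k)
  identity = solve-∀

sqrt5 : ∀ {N h} → Prime N → N ≡ suc (2 ℕ.* suc h) → N % 5 ≡ 4 → ∃ (IsSqrtMod N (+ 5))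
sqrt5 {N} {h} pN N≡ N%5≡4 = euler⇒sqrt pN {h} {+ 5} N≡ (5^h≈1 pN {suc h} N≡ N%5≡4)

-- This keeps the criterion from being vacuous for prime N; only N ≡ 4 (mod 5) requires work, namely
-- a square root of 5.
base-exists : ∀ {N h} → Prime N → N ≡ suc (2 ℕ.* suc h) → ¬ (N % 5 ≡ 1) → ∃ (IsBase N)
base-exists {N} {h} pN N≡ N%5≢1 = go (N % 5) ≡.refl (m%n<n N 5)
  where
  go : ∀ r → N % 5 ≡ r → r ℕ.< 5 → ∃ (IsBase N)
  go 0 eq _ = + 5 , five (inj₁ eq)
  go 1 eq _ = contradiction eq N%5≢1
  go 2 eq _ = + 5 , five (inj₂ (inj₁ eq))
  go 3 eq _ = + 5 , five (inj₂ (inj₂ eq))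
  go 4 eq _ = half-base {h = suc h} N≡ eq (proj₁ (sqrt5 pN N≡ eq)) (proj₂ (sqrt5 pN N≡ eq))
  go (suc (suc (suc (suc (suc _))))) _ (s≤s (s≤s (s≤s (s≤s (s≤s ())))))

prime[5] : Prime 5
prime[5] = toWitness {a? = prime? 5} _

5∤2^ : ∀ e → 5 ℕ∣.∤ 2 ℕ.^ e
5∤2^ zero 5∣1 with ℕ∣.∣1⇒≡1 5∣1
... | ()
5∤2^ (suc e) 5∣ with euclidsLemma 2 (2 ℕ.^ e) prime[5] 5∣
... | inj₁ 5∣2 = ℕ.<⇒≱ (s≤s (s≤s (s≤s z≤n))) (ℕ∣.∣⇒≤ 5∣2)
... | inj₂ 5∣ = 5∤2^ e 5∣

-- The criterion for N = 2^e t + 1.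

open import Data.Integer.Base using (-1ℤ) renaming (_^_ to _^ℤ_)
open import Data.Nat.Base using (_+_; _*_; _∸_; _^_; _<_; _>_)
open import Data.Nat.Divisibility using (_∤_)

theorem1p4 : (e t N : ℕ) → N ≡ 2 ^ e * t + 1 → N > 5 →
    2 ∤ t → t < 2 ^ e → t > 0 → 5 ∤ t →
    ((a : ℤ) → IsBase N a → (Prime N ⇔ (a ^ℤ ((N ∸ 1) / 2) ≡ -1ℤ [mod N ])))
    × (Prime N → ∃ λ (a : ℤ) → IsBase N a)
theorem1p4 zero t N _ _ _ t<1 t>0 _ = contradiction (ℕ.≤-<-trans t>0 t<1) (ℕ.<-irrefl ≡.refl)
theorem1p4 (suc k) t N N≡ N>5 _ t<2^e t>0 5∤t =
  (λ a isBase → mk⇔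
    (λ pN → subst (λ n → a ℤ.^ n ≡ ℤ.-1ℤ [mod N ]) (≡.sym half≡h) (base-^ {h = h} pN N>5 N≡1+2h isBase))
    (λ a^≡-1 → proth k t N≡ t<2^e t>0 (subst (λ n → a ℤ.^ n ≡ ℤ.-1ℤ [mod N ]) half≡h a^≡-1))) ,
  -- `base-exists` expects (N - 1)/2 as a successor; h is positive because t is.
  λ pN → base-exists pN (≡.trans N≡1+2h (cong (λ n → suc (2 ℕ.* n)) (≡.sym (ℕ.suc-pred h)))) N%5≢1
  where
  h = 2 ℕ.^ k ℕ.* t
  instance
    _ = ℕ.m^n≢0 2 k
    _ = ℕ.>-nonZero t>0
    _ = ℕ.m*n≢0 (2 ℕ.^ k) t
  N≡1+2^et : N ≡ suc (2 ℕ.^ suc k ℕ.* t)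
  N≡1+2^et = ≡.trans N≡ (ℕ.+-comm _ 1)
  N≡1+2h : N ≡ suc (2 ℕ.* h)
  N≡1+2h = ≡.trans N≡1+2^et (cong suc (ℕ.*-assoc 2 (2 ℕ.^ k) t))
  half≡h : (N ℕ.∸ 1) / 2 ≡ h
  half≡h = ≡.trans (cong (λ n → (n ℕ.∸ 1) / 2) (≡.trans N≡1+2h (cong suc (ℕ.*-comm 2 h)))) (m*n/n≡m h 2)
  -- N ≡ 1 (mod 5) would make 5 a divisor of N - 1 = 2^e t.
  N%5≢1 : ¬ (N % 5 ≡ 1)
  N%5≢1 N%5≡1 with euclidsLemma (2 ℕ.^ suc k) t prime[5]
    (ℕ∣.divides (N / 5) (ℕ.suc-injective (≡.trans (≡.sym N≡1+2^et)
      (≡.trans (m≡m%n+[m/n]*n N 5) (cong (ℕ._+ N / 5 ℕ.* 5) N%5≡1)))))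
  ... | inj₁ 5∣2^ = 5∤2^ (suc k) 5∣2^
  ... | inj₂ 5∣t  = 5∤t 5∣t
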